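{- Let $G$ be a finite group, $S$ a non-empty inverse-closed subset of $G\setminus\{1\}$, $\mathbb{F}$ a finite field, $B\le\mathbb{F}^S$ a linear code, and let $E$ be the edge set of $\mathrm{Cay}(G,S)$. Let $$A(G,S,B)=\{\sigma\in\mathrm{Aut}(G)\mid S^\sigma=S \text{ and the permutation } \sigma^S \text{ of } S \text{ induced by } \sigma \text{ lies in } \mathrm{Aut}(B)\}.$$ Then the automorphism group $\mathrm{Aut}(\mathbf{C}(G,S,B))$ of the Cayley code contains $G\rtimes A(G,S,B)$ (in its induced action on $E$). In particular, if $G\rtimes A(G,S,B)$ is transitive on $E$, then $\mathrm{Cay}(G,S)$ is normal edge-transitive and $\mathbf{C}(G,S,B)$ is symmetric.
   Context: For a finite set $X$, $\mathbb{F}^X$ is the $\mathbb{F}$-vector space of functions $f:X\to\mathbb{F}$; a linear code is a subspace $C\le\mathbb{F}^X$. $\mathrm{Aut}(C)$ is the group of all $\rho\in\mathrm{Sym}(X)$ whose induced action on $\mathbb{F}^X$ leaves $C$ invariant; $C$ is symmetric if $\mathrm{Aut}(C)$ is transitive on $X$. For a finite group $G$ and a non-empty inverse-closed subset $S\subseteq G\setminus\{1\}$, the Cayley graph $\mathrm{Cay}(G,S)$ has vertex set $G$ and edge set $E=\{\{g,sg\}\mid g\in G,\ s\in S\}$. It admits as automorphisms the elements of $G\rtimes A(G,S)$, where $A(G,S)=\{\sigma\in\mathrm{Aut}(G)\mid S^\sigma=S\}$, with $x\in G$ acting on vertices by $g\mapsto gx$ and $\sigma\in A(G,S)$ acting by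 $g\mapsto g^\sigma$; this induces an action on $E$. $\mathrm{Cay}(G,S)$ is normal edge-transitive if $G\rtimes A(G,S)$ is transitive on $E$. For a linear code $B\le\mathbb{F}^S$, the Cayley code is $$\mathbf{C}(G,S,B)=\{f\in\mathbb{F}^E\mid \text{for all } g\in G, \text{ the function } S\to\mathbb{F},\ s\mapsto f(\{g,sg\}), \text{ lies in } B\}.$$ -}

module Defs where

open import Level using (Level; _⊔_; suc)
open import Algebra.Bundles using (Group)
open import Algebra.Apartness.Bundles using (HeytingField)
open import Algebra.Morphism.Structures using (IsGroupIsomorphism)
import Algebra.Morphism.Construct.Composition as Compose
import Algebra.Morphism.Construct.Identity as Identity
open import Data.Nat.Base using (ℕ)
open import Data.Fin.Base using (Fin)
open import Data.Product.Base using (Σ; ∃; _×_; _,_; proj₁; proj₂)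
open import Data.Sum.Base using (_⊎_; inj₁; inj₂)
open import Function.Base using (_∘_)
open import Function.Bundles using (Inverse; Func; _⟶ₛ_; _⟨$⟩_; _⇔_; mk⇔; Equivalence)
import Function.Construct.Composition as ∘
import Function.Construct.Identity as Id
import Function.Construct.Symmetry as Symmetry
open import Relation.Binary.Bundles using (Setoid)
open import Relation.Binary.Definitions using (_Respects_)
import Relation.Binary.Construct.On as On
import Relation.Binary.PropositionalEquality.Properties as ≡
import Relation.Binary.Reasoning.Setoid as SetoidReasoning
open import Relation.Nullary.Negation using (¬_)
open import Relation.Unary using (Pred; Decidable; _≐_)

private
  variable
    a b c ℓ p q r : Level

Finite : Setoid c ℓ → Set (c ⊔ ℓ)
Finite X = ∃ λ (n : ℕ) → Inverse X (≡.setoid (Fin n))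

------------------------------------------------------------------------
-- Subgroups, symmetric groups and (right) group actions

record Subgroup (H : Group c ℓ) (p : Level) : Set (c ⊔ ℓ ⊔ suc p) where
  open Group H
  field
    Member : Pred Carrier p
    resp   : Member Respects _≈_
    ε∈     : Member ε
    ∙∈     : ∀ {x y} → Member x → Member y → Member (x ∙ y)
    ⁻¹∈    : ∀ {x} → Member x → Member (x ⁻¹)

  group : Group (c ⊔ p) ℓ
  group = record
    { Carrier = Σ Carrier Member
    ; _≈_     = λ x y → proj₁ x ≈ proj₁ y
    ; _∙_     = λ x y → proj₁ x ∙ proj₁ y , ∙∈ (proj₂ x) (proj₂ y)
    ; ε       = ε , ε∈
    ; _⁻¹     = λ x → proj₁ x ⁻¹ , ⁻¹∈ (proj₂ x)
    ; isGroup = record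
      { isMonoid = record
        { isSemigroup = record
          { isMagma = record
            { isEquivalence = On.isEquivalence proj₁ isEquivalence
            ; ∙-cong        = ∙-cong
            }
          ; assoc = λ x y z → assoc (proj₁ x) (proj₁ y) (proj₁ z)
          }
        ; identity = identityˡ ∘ proj₁ , identityʳ ∘ proj₁
        }
      ; inverse = inverseˡ ∘ proj₁ , inverseʳ ∘ proj₁
      ; ⁻¹-cong = ⁻¹-cong
      }
    }

infix 4 _∈_ _≤_

_∈_ : {H : Group c ℓ} → Group.Carrier H → Subgroup H p → Set p
x ∈ K = Subgroup.Member K x

_≤_ : {H : Group c ℓ} → Subgroup H p → Subgroup H q → Set (c ⊔ p ⊔ q)
K ≤ L = ∀ {x} → x ∈ K → x ∈ L

-- Permutations act on the right: ρ ∙ τ is "first ρ, then τ".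
Sym : Setoid c ℓ → Group (c ⊔ ℓ) (c ⊔ ℓ)
Sym X = record
  { Carrier = Inverse X X
  ; _≈_     = λ ρ τ → ∀ x → to ρ x ≈ to τ x
  ; _∙_     = ∘.inverse
  ; ε       = Id.inverse X
  ; _⁻¹     = Symmetry.inverse
  ; isGroup = record
    { isMonoid = record
      { isSemigroup = record
        { isMagma = record
          { isEquivalence = record
            { refl  = λ _ → refl
            ; sym   = λ ρ≈τ x → sym (ρ≈τ x)
            ; trans = λ ρ≈τ τ≈υ x → trans (ρ≈τ x) (τ≈υ x)
            }
          ; ∙-cong = λ {_} {_} {υ} ρ≈τ υ≈ω x → trans (to-cong υ (ρ≈τ x)) (υ≈ω _)
          }
        ; assoc = λ _ _ _ _ → refl
        }
      ; identity = (λ _ _ → refl) , (λ _ _ → refl)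
      }
    ; inverse = strictlyInverseˡ , strictlyInverseʳ
    ; ⁻¹-cong = λ {ρ} {τ} → from-≈ ρ τ
    }
  }
  where
  open Setoid X
  open Inverse
  from-≈ : ∀ (ρ τ : Inverse X X) → (∀ x → to ρ x ≈ to τ x) → ∀ x → from ρ x ≈ from τ x
  from-≈ ρ τ ρ≈τ x =
    inverseʳ ρ (trans (sym (strictlyInverseˡ τ x)) (sym (ρ≈τ (from τ x))))

record Action (H : Group a b) (X : Setoid c ℓ) : Set (a ⊔ b ⊔ c ⊔ ℓ) where
  private
    module H = Group H
    module X = Setoid X
  infixl 7 _◂_
  field
    _◂_    : X.Carrier → H.Carrier → X.Carrier
    ◂-cong : ∀ {x y g h} → x X.≈ y → g H.≈ h → x ◂ g X.≈ y ◂ h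
    ◂-ε    : ∀ x → x ◂ H.ε X.≈ x
    ◂-∙    : ∀ x g h → x ◂ (g H.∙ h) X.≈ x ◂ g ◂ h

  IsTransitive : Set (a ⊔ c ⊔ ℓ)
  IsTransitive = ∀ x y → ∃ λ h → x ◂ h X.≈ y

  ◂-cancelˡ : ∀ x h → x ◂ (h H.⁻¹) ◂ h X.≈ x
  ◂-cancelˡ x h =
    X.trans (X.sym (◂-∙ x _ _)) (X.trans (◂-cong X.refl (H.inverseˡ h)) (◂-ε x))

  ◂-cancelʳ : ∀ x h → x ◂ h ◂ (h H.⁻¹) X.≈ x
  ◂-cancelʳ x h =
    X.trans (X.sym (◂-∙ x _ _)) (X.trans (◂-cong X.refl (H.inverseʳ h)) (◂-ε x))

  perm : H.Carrier → Inverse X X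
  perm h = record
    { to        = _◂ h
    ; from      = _◂ (h H.⁻¹)
    ; to-cong   = λ x≈y → ◂-cong x≈y H.refl
    ; from-cong = λ x≈y → ◂-cong x≈y H.refl
    ; inverse   = (λ {x} y≈ → X.trans (◂-cong y≈ H.refl) (◂-cancelˡ x h))
                , (λ {x} y≈ → X.trans (◂-cong y≈ H.refl) (◂-cancelʳ x h))
    }

  -- The permutation group on X induced by H; the action need not be faithful.
  image : Subgroup (Sym X) (a ⊔ c ⊔ ℓ)
  image = record
    { Member = λ ρ → ∃ λ h → perm h S.≈ ρ
    ; resp   = λ {ρ} {τ} ρ≈τ (h , h≈ρ) → h , S.trans {perm h} {ρ} {τ} h≈ρ ρ≈τ
    ; ε∈     = H.ε , ◂-ε
    ; ∙∈     = λ {ρ} {τ} (g , g≈ρ) (h , h≈τ) → g H.∙ h ,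
                 λ x → X.trans (◂-∙ x g h)
                         (S.∙-cong {perm g} {ρ} {perm h} {τ} g≈ρ h≈τ x)
    ; ⁻¹∈    = λ {ρ} (h , h≈ρ) → h H.⁻¹ , S.⁻¹-cong {perm h} {ρ} h≈ρ
    }
    where module S = Group (Sym X)

naturalAction : {X : Setoid c ℓ} (K : Subgroup (Sym X) p) → Action (Subgroup.group K) X
naturalAction {X = X} K = record
  { _◂_    = λ x ρ → Inverse.to (proj₁ ρ) x
  ; ◂-cong = λ {x} {y} {ρ} x≈y ρ≈τ → trans (Inverse.to-cong (proj₁ ρ) x≈y) (ρ≈τ y)
  ; ◂-ε    = λ _ → refl
  ; ◂-∙    = λ _ _ _ → refl
  }
  where open Setoid X

------------------------------------------------------------------------
-- Aut(G) and the semidirect products G ⋊ A with A ≤ Aut(G)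

module _ (G : Group c ℓ) where

  open Group G
  open SetoidReasoning setoid

  record Automorphism : Set (c ⊔ ℓ) where
    field
      ⟦_⟧                : Carrier → Carrier
      isGroupIsomorphism : IsGroupIsomorphism rawGroup rawGroup ⟦_⟧

    open IsGroupIsomorphism isGroupIsomorphism public
      using (⟦⟧-cong; ∙-homo; ε-homo; ⁻¹-homo; injective; surjective)

    ⟦_⟧⁻¹ : Carrier → Carrier
    ⟦ y ⟧⁻¹ = proj₁ (surjective y)

    cancelˡ : ∀ y → ⟦ ⟦ y ⟧⁻¹ ⟧ ≈ y
    cancelˡ y = proj₂ (surjective y) refl

    cancelʳ : ∀ x → ⟦ ⟦ x ⟧ ⟧⁻¹ ≈ x
    cancelʳ x = injective (cancelˡ ⟦ x ⟧)

    ⟦⟧⁻¹-cong : ∀ {x y} → x ≈ y → ⟦ x ⟧⁻¹ ≈ ⟦ y ⟧⁻¹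
    ⟦⟧⁻¹-cong x≈y = injective (trans (cancelˡ _) (trans x≈y (sym (cancelˡ _))))

    inverse-isGroupIsomorphism : IsGroupIsomorphism rawGroup rawGroup ⟦_⟧⁻¹
    inverse-isGroupIsomorphism = record
      { isGroupMonomorphism = record
        { isGroupHomomorphism = record
          { isMonoidHomomorphism = record
            { isMagmaHomomorphism = record
              { isRelHomomorphism = record { cong = ⟦⟧⁻¹-cong }
              ; homo = λ x y → injective (begin
                  ⟦ ⟦ x ∙ y ⟧⁻¹ ⟧             ≈⟨ cancelˡ (x ∙ y) ⟩
                  x ∙ y                       ≈⟨ ∙-cong (cancelˡ x) (cancelˡ y) ⟨
                  ⟦ ⟦ x ⟧⁻¹ ⟧ ∙ ⟦ ⟦ y ⟧⁻¹ ⟧   ≈⟨ ∙-homo _ _ ⟨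
                  ⟦ ⟦ x ⟧⁻¹ ∙ ⟦ y ⟧⁻¹ ⟧       ∎)
              }
            ; ε-homo = injective (trans (cancelˡ ε) (sym ε-homo))
            }
          ; ⁻¹-homo = λ x → injective (begin
              ⟦ ⟦ x ⁻¹ ⟧⁻¹ ⟧     ≈⟨ cancelˡ (x ⁻¹) ⟩
              x ⁻¹               ≈⟨ ⁻¹-cong (cancelˡ x) ⟨
              ⟦ ⟦ x ⟧⁻¹ ⟧ ⁻¹     ≈⟨ ⁻¹-homo _ ⟨
              ⟦ ⟦ x ⟧⁻¹ ⁻¹ ⟧     ∎)
          }
        ; injective = λ {x} {y} eq →
            trans (sym (cancelˡ x)) (trans (⟦⟧-cong eq) (cancelˡ y))
        }
      ; surjective = λ x → ⟦ x ⟧ , λ z≈ → trans (⟦⟧⁻¹-cong z≈) (cancelʳ x)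
      }

  open Automorphism

  -- As for Sym, σ ∙ τ is "first σ, then τ".
  Aut : Group (c ⊔ ℓ) (c ⊔ ℓ)
  Aut = record
    { Carrier = Automorphism
    ; _≈_     = λ σ τ → ∀ x → ⟦ σ ⟧ x ≈ ⟦ τ ⟧ x
    ; _∙_     = λ σ τ → record
      { isGroupIsomorphism = Compose.isGroupIsomorphism trans
          (isGroupIsomorphism σ) (isGroupIsomorphism τ)
      }
    ; ε       = record { isGroupIsomorphism = Identity.isGroupIsomorphism rawGroup refl }
    ; _⁻¹     = λ σ → record { isGroupIsomorphism = inverse-isGroupIsomorphism σ }
    ; isGroup = record
      { isMonoid = record
        { isSemigroup = record
          { isMagma = record
            { isEquivalence = record
              { refl  = λ _ → refl
              ; sym   = λ σ≈τ x → sym (σ≈τ x)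
              ; trans = λ σ≈τ τ≈υ x → trans (σ≈τ x) (τ≈υ x)
              }
            ; ∙-cong = λ {_} {_} {υ} σ≈τ υ≈ω x → trans (⟦⟧-cong υ (σ≈τ x)) (υ≈ω _)
            }
          ; assoc = λ _ _ _ _ → refl
          }
        ; identity = (λ _ _ → refl) , (λ _ _ → refl)
        }
      ; inverse = cancelˡ , cancelʳ
      ; ⁻¹-cong = λ {σ} {τ} σ≈τ x → injective σ
          (trans (cancelˡ σ x) (trans (sym (cancelˡ τ x)) (sym (σ≈τ _))))
      }
    }

  -- The pair (σ , x) stands for the product σx, which sends g to g^σ x.  Hence
  -- (σx)(τy) = (στ)(x^τ y).
  semidirect : Subgroup Aut p → Group (c ⊔ ℓ ⊔ p) (c ⊔ ℓ)
  semidirect A = record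
    { Carrier = A.Carrier × Carrier
    ; _≈_     = λ (σ , x) (τ , y) → (σ A.≈ τ) × (x ≈ y)
    ; _∙_     = λ (σ , x) (τ , y) → σ A.∙ τ , ⟦ proj₁ τ ⟧ x ∙ y
    ; ε       = A.ε , ε
    ; _⁻¹     = λ (σ , x) → σ A.⁻¹ , ⟦ proj₁ σ ⟧⁻¹ (x ⁻¹)
    ; isGroup = record
      { isMonoid = record
        { isSemigroup = record
          { isMagma = record
            { isEquivalence = record
              { refl  = λ {(σ , _)} → A.refl {σ} , refl
              ; sym   = λ {(σ , _)} {(τ , _)} (p , q) → A.sym {σ} {τ} p , sym q
              ; trans = λ {(σ , _)} {(τ , _)} {(υ , _)} (p , q) (r , s) →
                          A.trans {σ} {τ} {υ} p r , trans q s
              }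
            ; ∙-cong = λ {(σ , _)} {(τ , _)} {(υ , _)} {(ω , _)} (p , q) (r , s) →
                A.∙-cong {σ} {τ} {υ} {ω} p r
                , ∙-cong (trans (⟦⟧-cong (proj₁ υ) q) (r _)) s
            }
          ; assoc = λ (σ , x) (τ , y) (υ , z) → A.assoc σ τ υ ,
              trans (∙-congʳ (∙-homo (proj₁ υ) _ y)) (assoc _ _ z)
          }
        ; identity = (λ (σ , x) → A.identityˡ σ ,
                        trans (∙-congʳ (ε-homo (proj₁ σ))) (identityˡ x))
                   , (λ (σ , x) → A.identityʳ σ , identityʳ x)
        }
      ; inverse = (λ (σ , x) → A.inverseˡ σ ,
                     trans (∙-congʳ (cancelˡ (proj₁ σ) _)) (inverseˡ x))
                , (λ (σ , x) → A.inverseʳ σ , injective (proj₁ σ)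
                     (begin
                       ⟦ proj₁ σ ⟧ (⟦ proj₁ σ ⟧⁻¹ x ∙ ⟦ proj₁ σ ⟧⁻¹ (x ⁻¹))
                         ≈⟨ ∙-homo (proj₁ σ) _ _ ⟩
                       ⟦ proj₁ σ ⟧ (⟦ proj₁ σ ⟧⁻¹ x) ∙ ⟦ proj₁ σ ⟧ (⟦ proj₁ σ ⟧⁻¹ (x ⁻¹))
                         ≈⟨ ∙-cong (cancelˡ (proj₁ σ) x) (cancelˡ (proj₁ σ) _) ⟩
                       x ∙ x ⁻¹
                         ≈⟨ inverseʳ x ⟩
                       ε
                         ≈⟨ ε-homo (proj₁ σ) ⟨
                       ⟦ proj₁ σ ⟧ ε ∎))
      ; ⁻¹-cong = λ {(σ , x)} {(τ , y)} (p , q) → A.⁻¹-cong {σ} {τ} p , injective (proj₁ σ)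
          (begin
            ⟦ proj₁ σ ⟧ (⟦ proj₁ σ ⟧⁻¹ (x ⁻¹))   ≈⟨ cancelˡ (proj₁ σ) _ ⟩
            x ⁻¹                                 ≈⟨ ⁻¹-cong q ⟩
            y ⁻¹                                 ≈⟨ cancelˡ (proj₁ τ) _ ⟨
            ⟦ proj₁ τ ⟧ (⟦ proj₁ τ ⟧⁻¹ (y ⁻¹))   ≈⟨ p _ ⟨
            ⟦ proj₁ σ ⟧ (⟦ proj₁ τ ⟧⁻¹ (y ⁻¹))   ∎)
      }
    }
    where module A = Group (Subgroup.group A)

  vertexAction : (A : Subgroup Aut p) → Action (semidirect A) setoid
  vertexAction A = record
    { _◂_    = λ g (σ , x) → ⟦ proj₁ σ ⟧ g ∙ x
    ; ◂-cong = λ {_} {_} {(σ , _)} g≈h (σ≈τ , x≈y) →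
                 ∙-cong (trans (⟦⟧-cong (proj₁ σ) g≈h) (σ≈τ _)) x≈y
    ; ◂-ε    = identityʳ
    ; ◂-∙    = λ g (σ , x) (τ , y) →
                 sym (trans (∙-congʳ (∙-homo (proj₁ τ) _ x)) (assoc _ _ y))
    }

infix 8 _⋊_
_⋊_ : (G : Group c ℓ) → Subgroup (Aut G) p → Group (c ⊔ ℓ ⊔ p) (c ⊔ ℓ)
G ⋊ A = semidirect G A

------------------------------------------------------------------------
-- Linear codes over a field F

-- On a finite carrier the apartness of a Heyting field is the negation of
-- equality, so HeytingField together with Finite is the usual notion of a
-- finite field (0 ≉ 1 follows from irreflexivity of the apartness).
module _ (F : HeytingField a b r) where

  private
    module F = HeytingField F

  scalars : Setoid a b
  scalars = F.setoid

  module _ (X : Setoid c ℓ) where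

    infixl 6 _⊕_
    infixr 7 _⊙_

    _⊕_ : X ⟶ₛ scalars → X ⟶ₛ scalars → X ⟶ₛ scalars
    f ⊕ g = record
      { to   = λ x → (f ⟨$⟩ x) F.+ (g ⟨$⟩ x)
      ; cong = λ x≈y → F.+-cong (Func.cong f x≈y) (Func.cong g x≈y)
      }

    _⊙_ : F.Carrier → X ⟶ₛ scalars → X ⟶ₛ scalars
    k ⊙ f = record
      { to   = λ x → k F.* (f ⟨$⟩ x)
      ; cong = λ x≈y → F.*-congˡ (Func.cong f x≈y)
      }

    𝟘 : X ⟶ₛ scalars
    𝟘 = record { to = λ _ → F.0# ; cong = λ _ → F.refl }

    record LinearCode (p : Level) : Set (a ⊔ b ⊔ c ⊔ ℓ ⊔ suc p) where
      field
        Word : Pred (X ⟶ₛ scalars) p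
        resp : ∀ {f g} → (∀ x → (f ⟨$⟩ x) F.≈ (g ⟨$⟩ x)) → Word f → Word g
        𝟘∈   : Word 𝟘
        ⊕∈   : ∀ {f g} → Word f → Word g → Word (f ⊕ g)
        ⊙∈   : ∀ k {f} → Word f → Word (k ⊙ f)

  module _ {X : Setoid c ℓ} where

    -- The induced right action of Sym(X) on F^X, (f ^ ρ)(x^ρ) = f(x).
    infixl 8 _^_
    _^_ : X ⟶ₛ scalars → Inverse X X → X ⟶ₛ scalars
    f ^ ρ = record
      { to   = λ x → f ⟨$⟩ Inverse.from ρ x
      ; cong = λ x≈y → Func.cong f (Inverse.from-cong ρ x≈y)
      }

    AutCode : LinearCode X p → Subgroup (Sym X) (a ⊔ b ⊔ c ⊔ ℓ ⊔ p)
    AutCode C = record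
      { Member = λ ρ → ∀ f → C.Word f ⇔ C.Word (f ^ ρ)
      ; resp   = λ {ρ} {τ} ρ≈τ ρ∈ f → mk⇔
          (C.resp (λ x → Func.cong f (S.⁻¹-cong {ρ} {τ} ρ≈τ x)) ∘ Equivalence.to (ρ∈ f))
          (Equivalence.from (ρ∈ f)
            ∘ C.resp (λ x → Func.cong f (X.sym (S.⁻¹-cong {ρ} {τ} ρ≈τ x))))
      ; ε∈     = λ f → mk⇔ (C.resp λ _ → F.refl) (C.resp λ _ → F.refl)
      ; ∙∈     = λ {ρ} {τ} ρ∈ τ∈ f → mk⇔
          (C.resp (λ _ → F.refl) ∘ Equivalence.to (τ∈ (f ^ ρ)) ∘ Equivalence.to (ρ∈ f))
          (Equivalence.from (ρ∈ f) ∘ Equivalence.from (τ∈ (f ^ ρ)) ∘ C.resp (λ _ → F.refl))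
      ; ⁻¹∈    = λ {ρ} ρ∈ f → mk⇔
          (Equivalence.from (ρ∈ (f ^ Symmetry.inverse ρ))
            ∘ C.resp (λ x → Func.cong f (X.sym (Inverse.strictlyInverseˡ ρ x))))
          (C.resp (λ x → Func.cong f (Inverse.strictlyInverseˡ ρ x))
            ∘ Equivalence.to (ρ∈ (f ^ Symmetry.inverse ρ)))
      }
      where
      module C = LinearCode C
      module S = Group (Sym X)
      module X = Setoid X

    IsSymmetric : LinearCode X p → Set (a ⊔ b ⊔ c ⊔ ℓ ⊔ p)
    IsSymmetric C = Action.IsTransitive (naturalAction (AutCode C))

------------------------------------------------------------------------
-- Cayley graphs

-- Decidability of membership makes S a finite set whenever G is finite.
record ConnectionSet (G : Group c ℓ) (p : Level) : Set (c ⊔ ℓ ⊔ suc p) where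
  open Group G
  field
    Member        : Pred Carrier p
    resp          : Member Respects _≈_
    member?       : Decidable Member
    nonEmpty      : ∃ Member
    inverseClosed : ∀ {s} → Member s → Member (s ⁻¹)
    ε∉            : ¬ Member ε

  elements : Setoid (c ⊔ p) ℓ
  elements = On.setoid {B = Σ Carrier Member} setoid proj₁

-- (x , y) represents the unordered pair {x , y}.
UnorderedPair : Setoid c ℓ → Setoid c ℓ
UnorderedPair X = record
  { Carrier = Carrier × Carrier
  ; _≈_     = λ (x , y) (z , w) → (x ≈ z × y ≈ w) ⊎ (x ≈ w × y ≈ z)
  ; isEquivalence = record
    { refl  = inj₁ (refl , refl)
    ; sym   = λ { (inj₁ (p , q)) → inj₁ (sym p , sym q)
                ; (inj₂ (p , q)) → inj₂ (sym q , sym p) }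
    ; trans = λ { (inj₁ (p , q)) (inj₁ (r , s)) → inj₁ (trans p r , trans q s)
                ; (inj₁ (p , q)) (inj₂ (r , s)) → inj₂ (trans p r , trans q s)
                ; (inj₂ (p , q)) (inj₁ (r , s)) → inj₂ (trans p s , trans q r)
                ; (inj₂ (p , q)) (inj₂ (r , s)) → inj₁ (trans p s , trans q r) }
    }
  }
  where open Setoid X

module _ (G : Group c ℓ) (S : ConnectionSet G p) where

  open Group G
  open Automorphism
  private
    module S = ConnectionSet S
    module Pair = Setoid (UnorderedPair setoid)
    module AutG = Group (Aut G)

  IsEdge : Pred (Carrier × Carrier) (c ⊔ ℓ ⊔ p)
  IsEdge e = ∃ λ g → ∃ λ s → S.Member s × e Pair.≈ (g , s ∙ g)

  Edges : Setoid (c ⊔ ℓ ⊔ p) ℓ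
  Edges = On.setoid {B = Σ (Carrier × Carrier) IsEdge} (UnorderedPair setoid) proj₁

  edge : Carrier → Setoid.Carrier S.elements → Setoid.Carrier Edges
  edge g (s , s∈S) = (g , s ∙ g) , g , s , s∈S , Pair.refl

  -- S^σ
  imageUnder : Automorphism G → Pred Carrier (c ⊔ ℓ ⊔ p)
  imageUnder σ t = ∃ λ s → S.Member s × ⟦ σ ⟧ s ≈ t

  A⟨G,S⟩ : Subgroup (Aut G) (c ⊔ ℓ ⊔ p)
  A⟨G,S⟩ = record
    { Member = λ σ → imageUnder σ ≐ S.Member
    ; resp   = λ σ≈τ (σS⊆S , S⊆σS) →
          (λ (s , s∈S , τs≈t) → σS⊆S (s , s∈S , trans (σ≈τ s) τs≈t))
        , (λ t∈S → let (s , s∈S , σs≈t) = S⊆σS t∈S in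
                   s , s∈S , trans (sym (σ≈τ s)) σs≈t)
    ; ε∈     = (λ (s , s∈S , s≈t) → S.resp s≈t s∈S)
             , (λ {t} t∈S → t , t∈S , refl)
    ; ∙∈     = λ {σ} {τ} (σS⊆S , S⊆σS) (τS⊆S , S⊆τS) →
          (λ (s , s∈S , eq) → τS⊆S (⟦ σ ⟧ s , σS⊆S (s , s∈S , refl) , eq))
        , (λ t∈S → let (u , u∈S , τu≈t) = S⊆τS t∈S
                       (s , s∈S , σs≈u) = S⊆σS u∈S in
                   s , s∈S , trans (⟦⟧-cong τ σs≈u) τu≈t)
    ; ⁻¹∈    = λ {σ} (σS⊆S , S⊆σS) →
          (λ (s , s∈S , σ⁻¹s≈t) → let (u , u∈S , σu≈s) = S⊆σS s∈S in
             S.resp (trans (injective σ (trans σu≈s (sym (cancelˡ σ s)))) σ⁻¹s≈t) u∈S)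
        , (λ {t} t∈S → ⟦ σ ⟧ t , σS⊆S (t , t∈S , refl) , cancelʳ σ t)
    }

  -- The permutation σ^S of S induced by σ.
  restrict : ∀ σ → σ ∈ A⟨G,S⟩ → Inverse S.elements S.elements
  restrict σ (σS⊆S , S⊆σS) = record
    { to        = λ (s , s∈S) → ⟦ σ ⟧ s , σS⊆S (s , s∈S , refl)
    ; from      = λ (t , t∈S) → let (s , s∈S , _) = S⊆σS t∈S in s , s∈S
    ; to-cong   = ⟦⟧-cong σ
    ; from-cong = λ {(_ , t∈S)} {(_ , u∈S)} t≈u → injective σ
        (trans (proj₂ (proj₂ (S⊆σS t∈S))) (trans t≈u (sym (proj₂ (proj₂ (S⊆σS u∈S))))))
    ; inverse   = (λ {(_ , t∈S)} s≈ → trans (⟦⟧-cong σ s≈) (proj₂ (proj₂ (S⊆σS t∈S))))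
                , (λ t≈ → injective σ (trans (proj₂ (proj₂ (S⊆σS _))) t≈))
    }

  -- The action on E induced by the action on vertices, for A ≤ A(G,S).
  edgeAction : (A : Subgroup (Aut G) q) → A ≤ A⟨G,S⟩ → Action (G ⋊ A) Edges
  edgeAction A A≤ = record
    { _◂_    = λ { ((x , y) , g , s , s∈S , xy≈) h@((σ , σ∈A) , z) →
          (x V.◂ h , y V.◂ h)
        , g V.◂ h , ⟦ σ ⟧ s , proj₁ (A≤ σ∈A) (s , s∈S , refl)
        , Pair.trans (map h xy≈)
            (inj₁ (refl , trans (∙-congʳ (∙-homo σ s g)) (assoc _ _ z))) }
    ; ◂-cong = λ {_} {(y , _)} {g} {h} x≈y g≈h → Pair.trans (map g x≈y)
        (inj₁ (V.◂-cong {g = g} {h} refl g≈h , V.◂-cong {g = g} {h} refl g≈h))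
    ; ◂-ε    = λ ((x , y) , _) → inj₁ (V.◂-ε x , V.◂-ε y)
    ; ◂-∙    = λ ((x , y) , _) g h → inj₁ (V.◂-∙ x g h , V.◂-∙ y g h)
    }
    where
    module V = Action (vertexAction G A)
    ◂-congʳ : ∀ h {x y} → x ≈ y → x V.◂ h ≈ y V.◂ h
    ◂-congʳ h x≈y = V.◂-cong {g = h} {h} x≈y (Group.refl (G ⋊ A) {h})
    map : ∀ h {x y z w} → (x , y) Pair.≈ (z , w) →
          (x V.◂ h , y V.◂ h) Pair.≈ (z V.◂ h , w V.◂ h)
    map h (inj₁ (p , q)) = inj₁ (◂-congʳ h p , ◂-congʳ h q)
    map h (inj₂ (p , q)) = inj₂ (◂-congʳ h p , ◂-congʳ h q)

  IsNormalEdgeTransitive : Set (c ⊔ ℓ ⊔ p)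
  IsNormalEdgeTransitive = Action.IsTransitive (edgeAction A⟨G,S⟩ (λ σ∈ → σ∈))

  ----------------------------------------------------------------------
  -- Cayley codes

  module _ (F : HeytingField a b r) (B : LinearCode F S.elements q) where

    private
      module F = HeytingField F
      module B = LinearCode B

    local : Edges ⟶ₛ F.setoid → Carrier → S.elements ⟶ₛ F.setoid
    local f g = record
      { to   = λ s → f ⟨$⟩ edge g s
      ; cong = λ s≈t → Func.cong f (inj₁ (refl , ∙-congʳ s≈t))
      }

    CayleyCode : LinearCode F Edges (c ⊔ q)
    CayleyCode = record
      { Word = λ f → ∀ g → B.Word (local f g)
      ; resp = λ f≈h f∈ g → B.resp (λ s → f≈h (edge g s)) (f∈ g)
      ; 𝟘∈   = λ g → B.resp (λ _ → F.refl) B.𝟘∈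
      ; ⊕∈   = λ f∈ h∈ g → B.resp (λ _ → F.refl) (B.⊕∈ (f∈ g) (h∈ g))
      ; ⊙∈   = λ k f∈ g → B.resp (λ _ → F.refl) (B.⊙∈ k (f∈ g))
      }

    A⟨G,S,B⟩ : Subgroup (Aut G) (a ⊔ b ⊔ c ⊔ ℓ ⊔ p ⊔ q)
    A⟨G,S,B⟩ = record
      { Member = λ σ → Σ (σ ∈ A⟨G,S⟩) λ σ∈ → restrict σ σ∈ ∈ AutB
      ; resp   = λ {σ} {τ} σ≈τ (σ∈ , σS∈) →
          let τ∈ = A.resp {σ} {τ} σ≈τ σ∈ in
          τ∈ , AutB.resp {restrict σ σ∈} {restrict τ τ∈} (σ≈τ ∘ proj₁) σS∈
      ; ε∈     = A.ε∈ ,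
          AutB.resp {SymS.ε} {restrict AutG.ε A.ε∈} (λ _ → refl) AutB.ε∈
      ; ∙∈     = λ {σ} {τ} (σ∈ , σS∈) (τ∈ , τS∈) →
          let στ∈ = A.∙∈ {σ} {τ} σ∈ τ∈
              σS  = restrict σ σ∈
              τS  = restrict τ τ∈ in
          στ∈ , AutB.resp {σS SymS.∙ τS} {restrict (σ AutG.∙ τ) στ∈} (λ _ → refl)
                  (AutB.∙∈ {σS} {τS} σS∈ τS∈)
      ; ⁻¹∈    = λ {σ} (σ∈ , σS∈) →
          let σ⁻¹∈ = A.⁻¹∈ {σ} σ∈
              σS   = restrict σ σ∈ in
          σ⁻¹∈ , AutB.resp {σS SymS.⁻¹} {restrict (σ AutG.⁻¹) σ⁻¹∈}
                   (λ (t , t∈S) → injective σ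
                      (trans (proj₂ (proj₂ (proj₂ σ∈ t∈S))) (sym (cancelˡ σ t))))
                   (AutB.⁻¹∈ {σS} σS∈)
      }
      where
      AutB = AutCode F B
      module A = Subgroup A⟨G,S⟩
      module AutB = Subgroup AutB
      module SymS = Group (Sym S.elements)

    edgeActionᴮ : Action (G ⋊ A⟨G,S,B⟩) Edges
    edgeActionᴮ = edgeAction A⟨G,S,B⟩ proj₁

{-# OPTIONS --safe #-}
-- Writing h = (σ , z), the edge {g , sg} is sent by h to {g^h , s^σ g^h}.  Hence
-- the local function at g of the pullback of f along h is the local function of
-- f at g^h, pulled back along the permutation σ^S, which preserves B.
module Submission where

open import Defs
open import Level using (Level)
open import Algebra.Bundles using (Group)
open import Algebra.Apartness.Bundles using (HeytingField)
open import Data.Product.Base using (_×_; _,_)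
open import Data.Sum.Base using (inj₁)
open import Function.Base using (_∘_)
open import Function.Bundles using (Func; Inverse; Equivalence; _⟶ₛ_; _⟨$⟩_; mk⇔)
open import Relation.Binary.Bundles using (Setoid)

private
  variable
    a b c d e ℓ p q r : Level

-- This is `f ^ ρ` with `ρ` inverted; it evaluates `f` at images, so no preimages of edges need
-- computing.
pullback : (F : HeytingField a b r) {X : Setoid c ℓ} →
           X ⟶ₛ scalars F → Inverse X X → X ⟶ₛ scalars F
pullback F f ρ = record
  { to   = λ x → f ⟨$⟩ Inverse.to ρ x
  ; cong = λ x≈y → Func.cong f (Inverse.to-cong ρ x≈y)
  }

module _ (F : HeytingField a b r) {X : Setoid c ℓ} (C : LinearCode F X p) where

  private
    module C = LinearCode C
    module F = HeytingField F

  -- Acting by `ρ` on the pullback gives back `f`, so the backward half of the equivalence `ρ∈`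
  -- applies.
  pullback-AutCode : ∀ {ρ} → ρ ∈ AutCode F C → ∀ {f} → C.Word f → C.Word (pullback F f ρ)
  pullback-AutCode {ρ} ρ∈ {f} f∈ = Equivalence.from (ρ∈ (pullback F f ρ))
    (C.resp (λ x → Func.cong f (Setoid.sym X (Inverse.strictlyInverseˡ ρ x))) f∈)

  -- One-sided stability suffices since `H` has inverses: `f ^ perm h` is the pullback of `f` along
  -- `h ⁻¹`, and pulling it back along `h` recovers `f`.
  image≤AutCode : {H : Group d e} (α : Action H X) →
    (∀ h {f} → C.Word f → C.Word (pullback F f (Action.perm α h))) →
    Action.image α ≤ AutCode F C
  image≤AutCode {H = H} α stable {ρ} (h , h≈ρ) =
    Subgroup.resp (AutCode F C) {perm h} {ρ} h≈ρ λ f → mk⇔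
      (C.resp (λ _ → F.refl) ∘ stable (h ⁻¹))
      (C.resp (λ x → Func.cong f (◂-cancelʳ x h)) ∘ stable h)
    where
    open Action α
    open Group H using (_⁻¹)

module _ (G : Group c ℓ) (S : ConnectionSet G p) (F : HeytingField a b r)
         (B : LinearCode F (ConnectionSet.elements S) q) where

  open Group G
  open Automorphism
  private
    module B = LinearCode B
    module V = Action (vertexAction G (A⟨G,S,B⟩ G S F B))
    module E = Action (edgeActionᴮ G S F B)

  edge-◂ : ∀ g s (h@((σ , σ∈ , _) , _) : Group.Carrier (G ⋊ A⟨G,S,B⟩ G S F B)) →
    Setoid._≈_ (Edges G S)
      (edge G S (g V.◂ h) (Inverse.to (restrict G S σ σ∈) s))
      (edge G S g s E.◂ h)
  edge-◂ g (s , _) ((σ , _) , z) =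
    -- The endpoints correspond without a swap; the second uses that `σ` is multiplicative.
    inj₁ (refl , sym (trans (∙-congʳ (∙-homo σ s g)) (assoc _ _ z)))

  CayleyCode-stable : ∀ h {f} → LinearCode.Word (CayleyCode G S F B) f →
    LinearCode.Word (CayleyCode G S F B) (pullback F f (E.perm h))
  CayleyCode-stable h@((σ , σ∈ , σS∈) , _) {f} f∈ g = B.resp
    (λ s → Func.cong f (edge-◂ g s h))
    (pullback-AutCode F B {restrict G S σ σ∈} σS∈ (f∈ (g V.◂ h)))

mainTheorem4 : ∀ {c ℓ p a b r q : Level}
    (G : Group c ℓ) → Finite (Group.setoid G) →
    (S : ConnectionSet G p) →
    (F : HeytingField a b r) → Finite (HeytingField.setoid F) →
    (B : LinearCode F (ConnectionSet.elements S) q) →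
    (Action.image (edgeActionᴮ G S F B) ≤ AutCode F (CayleyCode G S F B))
    × (Action.IsTransitive (edgeActionᴮ G S F B) →
    IsNormalEdgeTransitive G S × IsSymmetric F (CayleyCode G S F B))
mainTheorem4 G _ S F _ B = (λ {ρ} → image≤ {ρ}) , λ transitive →
    -- Dropping the condition on `B` from `σ` leaves its action on endpoints unchanged, so `eq`
    -- still applies.
    (λ x y → let (((σ , σ∈ , _) , z) , eq) = transitive x y in
             ((σ , σ∈) , z) , eq)
  -- The permutation of edges induced by `h` is the required code automorphism.
  , (λ x y → let (h , eq) = transitive x y in
             (E.perm h , image≤ {E.perm h} (h , λ e → Setoid.refl (Edges G S) {e E.◂ h})) , eq)
  where
  module E = Action (edgeActionᴮ G S F B)
  image≤ : E.image ≤ AutCode F (CayleyCode G S F B)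
  image≤ {ρ} = image≤AutCode F (CayleyCode G S F B) (edgeActionᴮ G S F B)
    (λ h {f} → CayleyCode-stable G S F B h {f}) {ρ}
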